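{- Let $G$ be a connected graph with $m$ edges. The transitive prune procedure applied to $G$ terminates and outputs a partition $\mathcal{P}$ of $E(G)$ such that: (i) each class of $\mathcal{P}$ is a clique of the $\varphi$-graph $\varphi(G)$; (ii) each class is a matching of $G$; (iii) if $G$ is a partial cube, $\mathcal{P}$ equals the set of $\theta$-classes of $G$; (iv) $|\mathcal{P}|\leq m$.
   Context: Graphs are finite, simple, connected and undirected; $d=d_G$ is the shortest-path distance. For edges $e=\{u,v\}$, $f=\{x,y\}$ of $G$: $e\mathrel{\varphi}f$ iff $d(u,x)=d(v,y)$ and $d(u,y)=d(v,x)$; $e\mathrel{\theta}f$ iff $d(u,x)+d(v,y)\neq d(u,y)+d(v,x)$. The $\varphi$-graph $\varphi(G)$ has vertex set $E(G)$, two elements being adjacent iff they are distinct and $\varphi$-related. A partial cube is a graph admitting an isometric embedding into a hypercube $Q_k$ (on a partial cube $\theta$ is an equivalence relation). The transitive prune: start with $H=\varphi(G)$ and $\mathcal{P}=\emptyset$; while $H$ has vertices, take a largest connected component $C$ of $H$; if $C$ is a clique, add the vertex set of $C$ to $\mathcal{P}$ as a class and delete it from $H$; otherwise, extract a clique $K$ of $H[C]$ (nonempty; a maximum clique when the search is exact, or one found by a greedy approximation for large components), add $K$ to $\mathcal{P}$ as a class, and delete it from $H$. Isolated vertices of $H$ become singleton classes. -}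

module Defs where

open import Data.Bool using (Bool; not)
open import Data.Empty using (⊥-elim)
open import Data.Fin using (Fin; _≟_)
open import Data.Fin.Properties using (any?)
open import Data.Fin.Subset using (Subset; _∈_; _⊆_; _∩_; _─_; ⊤; ∣_∣; Nonempty; Empty)
open import Data.List using (List; []; _∷_)
open import Data.List.Membership.Propositional using () renaming (_∈_ to _∈ˡ_)
open import Data.List.Relation.Unary.All using (All)
open import Data.List.Relation.Unary.AllPairs using (AllPairs)
open import Data.List.Relation.Unary.Any using (Any)
open import Data.Nat using (ℕ; zero; suc; _+_; _≤_; z≤n; s≤s)
open import Data.Product using (∃; ∃-syntax; Σ-syntax; _×_; _,_; proj₁; proj₂)
open import Data.Sum using (_⊎_)
open import Data.Vec using (Vec; _[_]%=_)
open import Function using (_∘_; flip; _⇔_)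
open import Induction.WellFounded using (Acc)
open import Relation.Binary.Construct.Closure.ReflexiveTransitive using (Star; ε; _◅_)
open import Relation.Binary.PropositionalEquality using (_≡_; _≢_; refl)
open import Relation.Nullary using (Dec; yes; no; ¬_)
open import Relation.Nullary.Decidable using (_×-dec_; _⊎-dec_; map′)

data Walk {A : Set} (R : A → A → Set) : A → A → ℕ → Set where
  []  : ∀ {u} → Walk R u u 0
  _∷_ : ∀ {u w v k} → R u w → Walk R w v k → Walk R u v (suc k)

-- k is the shortest-path distance from u to v in the graph with adjacency R.
IsDistance : {A : Set} (R : A → A → Set) → A → A → ℕ → Set
IsDistance R u v k = Walk R u v k × (∀ j → Walk R u v j → k ≤ j)

-- A finite simple graph on the vertex set Fin n whose edge set E(G) is Fin m.
-- The order of the two ends of an edge carries no meaning: `simple` forbids a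
-- second edge between the same two vertices in either order.
record Graph (n m : ℕ) : Set where
  field
    end₁ end₂ : Fin m → Fin n

  Joins : Fin m → Fin n → Fin n → Set
  Joins e u v = (end₁ e ≡ u × end₂ e ≡ v) ⊎ (end₁ e ≡ v × end₂ e ≡ u)

  field
    loopless : ∀ e → end₁ e ≢ end₂ e
    simple   : ∀ {e f u v} → Joins e u v → Joins f u v → e ≡ f

  Adj : Fin n → Fin n → Set
  Adj u v = ∃[ e ] Joins e u v

  Incident : Fin m → Fin n → Set
  Incident e v = end₁ e ≡ v ⊎ end₂ e ≡ v

  adj? : ∀ u v → Dec (Adj u v)
  adj? u v = any? λ e → ((end₁ e ≟ u) ×-dec (end₂ e ≟ v))
                      ⊎-dec ((end₁ e ≟ v) ×-dec (end₂ e ≟ u))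

Connected : ∀ {n m} → Graph n m → Set
Connected G = ∀ u v → Star (Graph.Adj G) u v

module _ {n m : ℕ} (G : Graph n m) where
  open Graph G

  walk? : ∀ k u v → Dec (Walk Adj u v k)
  walk? zero u v = map′ (λ { refl → [] }) (λ { [] → refl }) (u ≟ v)
  walk? (suc k) u v =
    map′ (λ { (_ , a , w) → a ∷ w }) (λ { (a ∷ w) → _ , a , w })
         (any? λ x → adj? u x ×-dec walk? k x v)

toWalk : ∀ {A : Set} {R : A → A → Set} {u v} → Star R u v → ∃ (Walk R u v)
toWalk ε       = 0 , []
toWalk (a ◅ p) = suc (proj₁ (toWalk p)) , a ∷ proj₂ (toWalk p)

least : ∀ {P : ℕ → Set} → (∀ k → Dec (P k)) → ∀ k → P k →
        ∃[ j ] (P j × (∀ i → P i → j ≤ i))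
least P? zero    pk = 0 , pk , λ _ _ → z≤n
least P? (suc k) pk with P? 0
... | yes p₀ = 0 , p₀ , λ _ _ → z≤n
... | no ¬p₀ with least (P? ∘ suc) k pk
...   | j , pj , min = suc j , pj , λ { zero p₀ → ⊥-elim (¬p₀ p₀) ; (suc i) p → s≤s (min i p) }

module _ {n m : ℕ} (G : Graph n m) (conn : Connected G) where
  open Graph G

  distance : ∀ u v → ∃ (IsDistance Adj u v)
  distance u v with toWalk (conn u v)
  ... | k , w = least (λ j → walk? G j u v) k w

  d : Fin n → Fin n → ℕ
  d u v = proj₁ (distance u v)

  -- Both relations are unchanged when the ends of e or of f are swapped.
  φ : Fin m → Fin m → Set
  φ e f = d (end₁ e) (end₁ f) ≡ d (end₂ e) (end₂ f)
        × d (end₁ e) (end₂ f) ≡ d (end₂ e) (end₁ f)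

  θ : Fin m → Fin m → Set
  θ e f = d (end₁ e) (end₁ f) + d (end₂ e) (end₂ f)
        ≢ d (end₁ e) (end₂ f) + d (end₂ e) (end₁ f)

  -- Adjacency of the φ-graph, whose vertex set is Fin m.
  φAdj : Fin m → Fin m → Set
  φAdj e f = e ≢ f × φ e f

-- Adjacency of the hypercube Q_k: exactly one coordinate is flipped.
CubeAdj : ∀ {k} → Vec Bool k → Vec Bool k → Set
CubeAdj x y = ∃[ i ] y ≡ x [ i ]%= not

PartialCube : ∀ {n m} (G : Graph n m) → Connected G → Set
PartialCube {n} G conn =
  ∃[ k ] Σ[ ι ∈ (Fin n → Vec Bool k) ]
    (∀ u v → IsDistance CubeAdj (ι u) (ι v) (d G conn u v))

module _ {m : ℕ} (R : Fin m → Fin m → Set) where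

  Induced : Subset m → Fin m → Fin m → Set
  Induced S x y = x ∈ S × y ∈ S × R x y

  IsComponent : Subset m → Subset m → Set
  IsComponent S C = ∃[ x ] (x ∈ S × (∀ y → y ∈ C ⇔ Star (Induced S) x y))

  IsLargestComponent : Subset m → Subset m → Set
  IsLargestComponent S C =
    IsComponent S C × (∀ C′ → IsComponent S C′ → ∣ C′ ∣ ≤ ∣ C ∣)

  IsClique : Subset m → Set
  IsClique K = ∀ {x y} → x ∈ K → y ∈ K → x ≢ y → R x y

module _ {n m : ℕ} (G : Graph n m) where
  open Graph G

  IsMatching : Subset m → Set
  IsMatching K = ∀ {e f} → e ∈ K → f ∈ K → e ≢ f → ¬ (∃[ v ] (Incident e v × Incident f v))

-- Nonempty, pairwise disjoint classes covering Fin m. In particular the list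
-- has no repetitions, so its length is the number of classes.
IsPartition : ∀ {m} → List (Subset m) → Set
IsPartition 𝒫 = All Nonempty 𝒫
              × AllPairs (λ A B → Empty (A ∩ B)) 𝒫
              × (∀ e → Any (e ∈_) 𝒫)

-- (S , 𝒫): H is the subgraph of the φ-graph induced by S, and 𝒫 lists the
-- classes produced so far.
State : ℕ → Set
State m = Subset m × List (Subset m)

module _ {n m : ℕ} (G : Graph n m) (conn : Connected G) where

  -- One iteration of the loop. It is a relation because the procedure leaves
  -- open which largest component is taken and which nonempty clique of it the
  -- (exact or greedy) search returns. An isolated vertex of H is a component
  -- that is a clique, so `whole` makes it a singleton class.
  data Step : State m → State m → Set where
    whole : ∀ {S 𝒫 C} →
      IsLargestComponent (φAdj G conn) S C →
      IsClique (φAdj G conn) C →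
      Step (S , 𝒫) (S ─ C , C ∷ 𝒫)
    extract : ∀ {S 𝒫 C K} →
      IsLargestComponent (φAdj G conn) S C →
      ¬ IsClique (φAdj G conn) C →
      K ⊆ C → Nonempty K → IsClique (φAdj G conn) K →
      Step (S , 𝒫) (S ─ K , K ∷ 𝒫)

  start : State m
  start = ⊤ , []

  -- No execution is infinite, and none gets stuck while H has vertices.
  Terminates : Set
  Terminates =
      Acc (flip Step) start
    × (∀ {S 𝒫} → Star Step start (S , 𝒫) → Nonempty S → ∃ (Step (S , 𝒫)))

  Outputs : List (Subset m) → Set
  Outputs 𝒫 = ∃[ S ] (Star Step start (S , 𝒫) × Empty S)

  IsθClass : Subset m → Set
  IsθClass A = ∃[ e ] ∀ f → f ∈ A ⇔ θ G conn e f

  EqualsθClasses : List (Subset m) → Set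
  EqualsθClasses 𝒫 = ∀ A → A ∈ˡ 𝒫 ⇔ IsθClass A

{-# OPTIONS --safe #-}

-- Along a run the classes and the remaining set S always partition the edges,
-- and each step removes a nonempty clique from S, so |S| + |𝒫| ≤ m throughout.
-- A clique of the φ-graph is a matching because φ-related edges with a common
-- end have their other ends at distance 0.  In a partial cube each edge flips one
-- coordinate of the hypercube, and "same coordinate ⇒ φ ⇒ θ ⇒ same coordinate"
-- makes φ an equivalence relation equal to θ: S stays a union of φ-classes, every
-- component is a whole class, and extraction never happens.
module Submission where

open import Defs
open import Algebra.Properties.CommutativeSemigroup using (interchange)
open import Data.Bool using (Bool; true; false; not; _xor_; if_then_else_)
open import Data.Empty using (⊥-elim)
open import Data.Fin using (Fin; zero; suc; _≟_)
open import Data.Fin.Properties using (any?; all?)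
open import Data.Fin.Subset
  using (Subset; _∈_; _∉_; _⊆_; _⊂_; _⊃_; _∩_; _∪_; _─_; ⁅_⁆; ∣_∣; Nonempty; Empty; inside)
open import Data.Fin.Subset.Induction using (⊂-wellFounded; ⊃-wellFounded)
open import Data.Fin.Subset.Properties
  using (_∈?_; ∈⊤; ∣⊤∣≡n; x∈⁅x⁆; x∈⁅y⁆⇒x≡y; x∈p∩q⁺; x∈p∩q⁻; x∈p∪q⁻; p⊆p∪q; q⊆p∪q;
         x∈p∧x∉q⇒x∈p─q; p─q⊆p; p∩q≢∅⇒p─q⊂p; p⊂q⇒∣p∣<∣q∣; p⊆q⇒∣p∣≤∣q∣; ⊆-antisym)
open import Data.List using ([]; _∷_; length; filter; allFin)
open import Data.List.Extrema.Nat using (argmax; argmax-all; f[xs]≤f[argmax])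
open import Data.List.Membership.Propositional using (find) renaming (_∈_ to _∈ˡ_)
open import Data.List.Membership.Propositional.Properties using (∈-filter⁺; ∈-allFin)
open import Data.List.Relation.Unary.All as All using (All; []; _∷_)
open import Data.List.Relation.Unary.All.Properties using (all-filter)
open import Data.List.Relation.Unary.AllPairs using (AllPairs; []; _∷_)
open import Data.List.Relation.Unary.Any using (Any; here; there)
open import Data.Nat using (ℕ; zero; suc; _+_; _≤_; z≤n; s≤s)
import Data.Nat as ℕ
open import Data.Nat.Properties
  using (≤-antisym; ≤-refl; ≤-reflexive; ≤-trans; n≤0⇒n≡0; +-suc; +-identityʳ; +-comm;
         +-mono-≤; +-monoˡ-≤; +-monoʳ-≤; m≤n+m;
         +-cancelˡ-≡; +-cancelʳ-≡; +-commutativeSemigroup; suc-injective)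
open import Data.Product using (∃; ∃-syntax; _×_; _,_; proj₁; proj₂)
open import Data.Sum using (_⊎_; inj₁; inj₂)
open import Data.Vec using (Vec; []; _∷_; here; there; _[_]%=_)
open import Function using (_∘_; id; flip; _⇔_; mk⇔; Equivalence)
open import Induction.WellFounded using (Acc; acc)
open import Relation.Binary.Construct.Closure.ReflexiveTransitive as Star using (Star; ε; _◅_; _◅◅_)
open import Relation.Binary.PropositionalEquality
  using (_≡_; _≢_; refl; sym; trans; cong; cong₂; subst; module ≡-Reasoning)
open import Relation.Nullary using (Dec; yes; no; contradiction)
open import Relation.Nullary.Decidable using (_×-dec_; _→-dec_; ¬?; map′; decidable-stable)

open Equivalence using (to; from)

-- Set difference and disjointness of finite subsets

x∈p─q⇒x∉q : ∀ {n} {x : Fin n} (p q : Subset n) → x ∈ p ─ q → x ∉ q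
x∈p─q⇒x∉q (_ ∷ p) (inside ∷ q) ()        here
x∈p─q⇒x∉q (_ ∷ p) (_ ∷ q)      (there s) (there t) = x∈p─q⇒x∉q p q s t

x∈p⇒x∈p─q⊎x∈q : ∀ {n} {x : Fin n} {p : Subset n} (q : Subset n) → x ∈ p → x ∈ p ─ q ⊎ x ∈ q
x∈p⇒x∈p─q⊎x∈q {x = x} q x∈p with x ∈? q
... | yes x∈q = inj₂ x∈q
... | no  x∉q = inj₁ (x∈p∧x∉q⇒x∈p─q x∈p x∉q)

q⊆p⇒p─q⊂p : ∀ {n} {p q : Subset n} → q ⊆ p → Nonempty q → p ─ q ⊂ p
q⊆p⇒p─q⊂p {p = p} {q} q⊆p (x , x∈q) = p∩q≢∅⇒p─q⊂p p q (x , x∈p∩q⁺ (q⊆p x∈q , x∈q))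

∩-empty : ∀ {n} {A B : Subset n} → (∀ {x} → x ∈ A → x ∉ B) → Empty (A ∩ B)
∩-empty {A = A} {B} disj (x , x∈) = let a , b = x∈p∩q⁻ A B x∈ in disj a b

∩-empty-monoʳ : ∀ {n} {A B C : Subset n} → C ⊆ B → Empty (A ∩ B) → Empty (A ∩ C)
∩-empty-monoʳ C⊆B e = ∩-empty λ a c → e (_ , x∈p∩q⁺ (a , C⊆B c))

∩-empty-sym : ∀ {n} {A B : Subset n} → Empty (A ∩ B) → Empty (B ∩ A)
∩-empty-sym e = ∩-empty λ b a → e (_ , x∈p∩q⁺ (a , b))

-- Components and cliques of decidable relations

module _ {m : ℕ} {R : Fin m → Fin m → Set} (R? : ∀ x y → Dec (R x y)) where

  -- Saturation from the singleton of `x`: while some `R`-step leaves `C`, its target is added, and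
  -- such strict growth must stop in a finite set. When no step leaves `C`, every path from `x`
  -- stays inside.
  closure : ∀ x → ∃[ C ] (∀ y → y ∈ C ⇔ Star R x y)
  closure x = grow ⁅ x ⁆ (⊃-wellFounded ⁅ x ⁆) (x∈⁅x⁆ x)
                   (λ y∈ → subst (Star R x) (sym (x∈⁅y⁆⇒x≡y x y∈)) ε)
    where
    grow : ∀ C → Acc _⊃_ C → x ∈ C → (∀ {y} → y ∈ C → Star R x y) →
           ∃[ C ] (∀ y → y ∈ C ⇔ Star R x y)
    grow C (acc rs) x∈C sound
      with any? (λ y → any? λ z → y ∈? C ×-dec ¬? (z ∈? C) ×-dec R? y z)
    ... | no stuck = C , λ y → mk⇔ sound (closed x∈C)
      where
      closed : ∀ {y z} → y ∈ C → Star R y z → z ∈ C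
      closed y∈C ε = y∈C
      closed {y} y∈C (_◅_ {j = w} r p) =
        closed (decidable-stable (w ∈? C) λ w∉C → stuck (y , w , y∈C , w∉C , r)) p
    ... | yes (y , z , y∈C , z∉C , r) =
      grow (C ∪ ⁅ z ⁆) (rs (p⊆p∪q _ , z , q⊆p∪q _ _ (x∈⁅x⁆ z) , z∉C)) (p⊆p∪q _ x∈C) sound′
      where
      sound′ : ∀ {w} → w ∈ C ∪ ⁅ z ⁆ → Star R x w
      sound′ w∈ with x∈p∪q⁻ C ⁅ z ⁆ w∈
      ... | inj₁ w∈C = sound w∈C
      ... | inj₂ w∈z = subst (Star R x) (sym (x∈⁅y⁆⇒x≡y z w∈z)) (sound y∈C ◅◅ (r ◅ ε))

maximiser : ∀ {m} {P : Fin m → Set} → (∀ x → Dec (P x)) → (f : Fin m → ℕ) → ∃ P →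
            ∃[ x ] (P x × (∀ y → P y → f y ≤ f x))
maximiser {P = P} P? f (x₀ , p₀) =
    argmax f x₀ xs
  -- The default `x₀` satisfies `P` as well, so the result does whichever candidate wins.
  , argmax-all f {P = P} p₀ (all-filter P? (allFin _))
  , λ y py → All.lookup (f[xs]≤f[argmax] {f = f} x₀ xs) (∈-filter⁺ P? (∈-allFin y) py)
  where xs = filter P? (allFin _)

module _ {m : ℕ} {R : Fin m → Fin m → Set} (R? : ∀ x y → Dec (R x y)) where

  isClique? : ∀ K → Dec (IsClique R K)
  isClique? K = map′ (λ h {x} {y} → h x y) (λ h x y → h)
    (all? λ x → all? λ y → (x ∈? K) →-dec (y ∈? K) →-dec ¬? (x ≟ y) →-dec R? x y)

  largestComponent : ∀ S → Nonempty S → ∃ (IsLargestComponent R S)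
  largestComponent S ne =
      proj₁ (comp x)
    , (x , x∈S , proj₂ (comp x))
    -- Any component is the reachability set of some `x′` in `S`, so maximising over the vertices of
    -- `S` covers all components.
    , λ { C′ (x′ , x′∈S , C′⇔) →
          ≤-trans (p⊆q⇒∣p∣≤∣q∣ λ {y} y∈ → from (proj₂ (comp x′) y) (to (C′⇔ y) y∈))
                  (largest x′ x′∈S) }
    where
    comp : ∀ x → ∃[ C ] (∀ y → y ∈ C ⇔ Star (Induced R S) x y)
    comp = closure λ x y → x ∈? S ×-dec y ∈? S ×-dec R? x y
    best = maximiser (_∈? S) (∣_∣ ∘ proj₁ ∘ comp) ne
    x = proj₁ best
    x∈S = proj₁ (proj₂ best)
    largest = proj₂ (proj₂ best)

module _ {m : ℕ} {R : Fin m → Fin m → Set} {S C : Subset m} where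

  component-nonempty : IsComponent R S C → Nonempty C
  component-nonempty (x , _ , C⇔) = x , from (C⇔ x) ε

  component-⊆ : IsComponent R S C → C ⊆ S
  component-⊆ (x , x∈S , C⇔) {y} y∈C = stays x∈S (to (C⇔ y) y∈C)
    where
    stays : ∀ {a b} → a ∈ S → Star (Induced R S) a b → b ∈ S
    stays a∈S ε = a∈S
    stays _ ((_ , b∈S , _) ◅ p) = stays b∈S p

-- Hamming distance

bit : Bool → Bool → ℕ
bit a b = if a xor b then 1 else 0

hamming : ∀ {k} → Vec Bool k → Vec Bool k → ℕ
hamming []      []      = 0
hamming (a ∷ x) (b ∷ y) = bit a b + hamming x y

bit-self : ∀ a → bit a a ≡ 0
bit-self true  = refl
bit-self false = refl

bit-not-both : ∀ a b → bit (not a) (not b) ≡ bit a b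
bit-not-both true  true  = refl
bit-not-both true  false = refl
bit-not-both false true  = refl
bit-not-both false false = refl

bit-not-swap : ∀ a b → bit a (not b) ≡ bit (not a) b
bit-not-swap true  true  = refl
bit-not-swap true  false = refl
bit-not-swap false true  = refl
bit-not-swap false false = refl

bit-not-≢ : ∀ a b → bit a (not b) ≢ bit a b
bit-not-≢ true  true  ()
bit-not-≢ true  false ()
bit-not-≢ false true  ()
bit-not-≢ false false ()

-- A bit is at most 1, so `c` is arbitrary; it is later the bit after a flip.
bit≤1+ : ∀ a b c → bit a b ≤ suc c
bit≤1+ true  true  _ = z≤n
bit≤1+ true  false _ = s≤s z≤n
bit≤1+ false true  _ = s≤s z≤n
bit≤1+ false false _ = z≤n

flipAt : ∀ {k} → Fin k → Vec Bool k → Vec Bool k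
flipAt i x = x [ i ]%= not

hamming-self : ∀ {k} (x : Vec Bool k) → hamming x x ≡ 0
hamming-self []      = refl
hamming-self (a ∷ x) = cong₂ _+_ (bit-self a) (hamming-self x)

hamming-flip-both : ∀ {k} i (x y : Vec Bool k) → hamming (flipAt i x) (flipAt i y) ≡ hamming x y
hamming-flip-both zero    (a ∷ x) (b ∷ y) = cong (_+ hamming x y) (bit-not-both a b)
hamming-flip-both (suc i) (a ∷ x) (b ∷ y) = cong (bit a b +_) (hamming-flip-both i x y)

hamming-flip-swap : ∀ {k} i (x y : Vec Bool k) → hamming x (flipAt i y) ≡ hamming (flipAt i x) y
hamming-flip-swap zero    (a ∷ x) (b ∷ y) = cong (_+ hamming x y) (bit-not-swap a b)
hamming-flip-swap (suc i) (a ∷ x) (b ∷ y) = cong (bit a b +_) (hamming-flip-swap i x y)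

-- A flip changes exactly one summand, from 0 to 1 or back. This is the parity fact behind `φ⇒θ`.
hamming-flip-≢ : ∀ {k} i (x y : Vec Bool k) → hamming x (flipAt i y) ≢ hamming x y
hamming-flip-≢ zero    (a ∷ x) (b ∷ y) eq = bit-not-≢ a b (+-cancelʳ-≡ (hamming x y) _ _ eq)
hamming-flip-≢ (suc i) (a ∷ x) (b ∷ y) eq = hamming-flip-≢ i x y (+-cancelˡ-≡ (bit a b) _ _ eq)

+-interchange : ∀ a b c e → (a + b) + (c + e) ≡ (a + c) + (b + e)
+-interchange = interchange +-commutativeSemigroup

-- Flips in different coordinates alter different summands, so their effects add up independently
-- and the two sums balance. For edges in directions `i` and `j` this equation is the failure of θ.
hamming-flip-distinct : ∀ {k} {i j : Fin k} → i ≢ j → ∀ x y →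
  hamming x y + hamming (flipAt i x) (flipAt j y) ≡ hamming x (flipAt j y) + hamming (flipAt i x) y
hamming-flip-distinct {i = zero}  {zero}  i≢j _ _ = contradiction refl i≢j
hamming-flip-distinct {i = zero}  {suc j} i≢j (a ∷ x) (b ∷ y) = begin
  (p + X) + (q + Y)  ≡⟨ +-interchange p X q Y ⟩
  (p + q) + (X + Y)  ≡⟨ cong (p + q +_) (+-comm X Y) ⟩
  (p + q) + (Y + X)  ≡⟨ +-interchange p q Y X ⟩
  (p + Y) + (q + X)  ∎
  where
  open ≡-Reasoning
  p = bit a b
  q = bit (not a) b
  X = hamming x y
  Y = hamming x (flipAt j y)
hamming-flip-distinct {i = suc i} {zero}  i≢j (a ∷ x) (b ∷ y) = begin
  (p + X) + (q + Y)  ≡⟨ +-interchange p X q Y ⟩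
  (p + q) + (X + Y)  ≡⟨ cong (_+ (X + Y)) (+-comm p q) ⟩
  (q + p) + (X + Y)  ≡⟨ +-interchange q p X Y ⟩
  (q + X) + (p + Y)  ∎
  where
  open ≡-Reasoning
  p = bit a b
  q = bit a (not b)
  X = hamming x y
  Y = hamming (flipAt i x) y
hamming-flip-distinct {i = suc i} {suc j} i≢j (a ∷ x) (b ∷ y) = begin
  (p + X) + (p + Y)  ≡⟨ +-interchange p X p Y ⟩
  (p + p) + (X + Y)  ≡⟨ cong (p + p +_) (hamming-flip-distinct (i≢j ∘ cong suc) x y) ⟩
  (p + p) + (Z + W)  ≡⟨ +-interchange p p Z W ⟩
  (p + Z) + (p + W)  ∎
  where
  open ≡-Reasoning
  p = bit a b
  X = hamming x y
  Y = hamming (flipAt i x) (flipAt j y)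
  Z = hamming x (flipAt j y)
  W = hamming (flipAt i x) y

hamming≤1+hamming-flip : ∀ {k} i (x y : Vec Bool k) → hamming x y ≤ suc (hamming (flipAt i x) y)
hamming≤1+hamming-flip zero    (a ∷ x) (b ∷ y) =
  +-mono-≤ (bit≤1+ a b (bit (not a) b)) (≤-refl {hamming x y})
hamming≤1+hamming-flip (suc i) (a ∷ x) (b ∷ y) =
  ≤-trans (+-monoʳ-≤ (bit a b) (hamming≤1+hamming-flip i x y)) (≤-reflexive (+-suc (bit a b) _))

-- Hamming distance as the shortest-path distance of the hypercube

cubeWalk-∷ : ∀ {k l} {x y : Vec Bool k} a → Walk CubeAdj x y l → Walk CubeAdj (a ∷ x) (a ∷ y) l
cubeWalk-∷ a []             = []
cubeWalk-∷ a ((i , eq) ∷ w) = (suc i , cong (a ∷_) eq) ∷ cubeWalk-∷ a w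

hammingWalk : ∀ {k} (x y : Vec Bool k) → Walk CubeAdj x y (hamming x y)
hammingWalk []          []          = []
hammingWalk (true  ∷ x) (true  ∷ y) = cubeWalk-∷ true (hammingWalk x y)
hammingWalk (true  ∷ x) (false ∷ y) = (zero , refl) ∷ cubeWalk-∷ false (hammingWalk x y)
hammingWalk (false ∷ x) (true  ∷ y) = (zero , refl) ∷ cubeWalk-∷ true (hammingWalk x y)
hammingWalk (false ∷ x) (false ∷ y) = cubeWalk-∷ false (hammingWalk x y)

hamming≤walk : ∀ {k j} {x y : Vec Bool k} → Walk CubeAdj x y j → hamming x y ≤ j
hamming≤walk {x = x}         []                = ≤-reflexive (hamming-self x)
hamming≤walk {x = x} {y = y} ((i , refl) ∷ w) =
  ≤-trans (hamming≤1+hamming-flip i x y) (s≤s (hamming≤walk w))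

hamming-isDistance : ∀ {k} (x y : Vec Bool k) → IsDistance CubeAdj x y (hamming x y)
hamming-isDistance x y = hammingWalk x y , λ _ → hamming≤walk

isDistance-unique : ∀ {A : Set} {R : A → A → Set} {u v k l} →
                    IsDistance R u v k → IsDistance R u v l → k ≡ l
isDistance-unique (w , min) (w′ , min′) = ≤-antisym (min _ w′) (min′ _ w)

-- Equations between sums of distances

n+n-injective : ∀ {a b} → a + a ≡ b + b → a ≡ b
n+n-injective {zero}  {zero}  _  = refl
n+n-injective {suc a} {suc b} eq =
  cong suc (n+n-injective
    (suc-injective (trans (sym (+-suc a a)) (trans (suc-injective eq) (+-suc b b)))))

-- Its first two hypotheses are the two equations of φ and the third is the failure of θ; together
-- they read `a + a ≡ b + b`.
equal-summands : ∀ {a b c e} → a ≡ e → b ≡ c → a + e ≡ b + c → a ≡ b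
equal-summands refl refl = n+n-injective

+-≡-resp : ∀ {a a′ b b′ c c′ e e′} → a ≡ a′ → e ≡ e′ → b ≡ b′ → c ≡ c′ →
           a′ + e′ ≡ b′ + c′ → a + e ≡ b + c
+-≡-resp refl refl refl refl = id

-- Distances in `G`, φ-cliques and matchings

module _ {n m : ℕ} (G : Graph n m) (conn : Connected G) where
  open Graph G

  private
    dist = d G conn
    _~_  = φAdj G conn

  φAdj? : ∀ e f → Dec (e ~ f)
  φAdj? e f = ¬? (e ≟ f) ×-dec (_ ℕ.≟ _) ×-dec (_ ℕ.≟ _)

  d-self : ∀ u → dist u u ≡ 0
  d-self u = n≤0⇒n≡0 (proj₂ (proj₂ (distance G conn u u)) 0 [])

  d≡0⇒≡ : ∀ {u v} → dist u v ≡ 0 → u ≡ v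
  d≡0⇒≡ {u} {v} d≡0 with subst (Walk Adj u v) d≡0 (proj₁ (proj₂ (distance G conn u v)))
  ... | [] = refl

  -- The edge itself is a walk of length 1, and distance 0 would make it a loop.
  d-edge : ∀ e → dist (end₁ e) (end₂ e) ≡ 1
  d-edge e with dist (end₁ e) (end₂ e) in eq
              | proj₂ (proj₂ (distance G conn (end₁ e) (end₂ e))) 1 ((e , inj₁ (refl , refl)) ∷ [])
  ... | 0 | _ = contradiction (d≡0⇒≡ eq) (loopless e)
  ... | 1 | _ = refl
  ... | suc (suc _) | s≤s ()

  clique⇒matching : ∀ {K} → IsClique _~_ K → IsMatching G K
  clique⇒matching clique {e} {f} e∈K f∈K e≢f (v , ev , fv) = e≢f (coincide ev fv)
    where
    φef = proj₂ (clique e∈K f∈K e≢f)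
    -- With `a` and `b` both the shared end, one equation of φ puts the two other ends at distance
    -- 0. Both edges then join the same two vertices, and `simple` identifies them.
    at0 : ∀ {a b x y} → a ≡ v → b ≡ v → dist a b ≡ dist x y → x ≡ y
    at0 refl refl eq = d≡0⇒≡ (trans (sym eq) (d-self v))
    coincide : Incident e v → Incident f v → e ≡ f
    coincide (inj₁ p) (inj₁ q) =
      simple (inj₁ (p , at0 p q (proj₁ φef))) (inj₁ (q , refl))
    coincide (inj₁ p) (inj₂ q) =
      simple (inj₁ (p , at0 p q (proj₂ φef))) (inj₂ (refl , q))
    coincide (inj₂ p) (inj₁ q) =
      simple (inj₂ (at0 p q (sym (proj₂ φef)) , p)) (inj₁ (q , refl))
    coincide (inj₂ p) (inj₂ q) =
      simple (inj₂ (at0 p q (sym (proj₁ φef)) , p)) (inj₂ (refl , q))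

  -- The coordinate flipped along an edge of a partial cube labels its θ-class.
  record Direction : Set where
    field
      {dim}  : ℕ
      dir    : Fin m → Fin dim
      dir⇒φ : ∀ {e f} → dir e ≡ dir f → φ G conn e f
      φ⇒θ   : ∀ {e f} → φ G conn e f → θ G conn e f
      θ⇒dir : ∀ {e f} → θ G conn e f → dir e ≡ dir f

    dir⇒θ : ∀ {e f} → dir e ≡ dir f → θ G conn e f
    dir⇒θ = φ⇒θ ∘ dir⇒φ

  -- The isometry turns the four distances between the ends of two edges into Hamming distances
  -- between two words and their flips, where the flip lemmas apply.
  direction : PartialCube G conn → Direction
  direction (k , ι , iso) = record
    { dir = dir ; dir⇒φ = dir⇒φ ; φ⇒θ = λ {e} {f} → φ⇒θ {e} {f} ; θ⇒dir = θ⇒dir }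
    where
    d≡ : ∀ u v → dist u v ≡ hamming (ι u) (ι v)
    d≡ u v = isDistance-unique (iso u v) (hamming-isDistance (ι u) (ι v))

    -- The ends are at distance 1, so the embedding yields a cube walk of length 1, whose only step
    -- names the coordinate.
    flips : ∀ e → CubeAdj (ι (end₁ e)) (ι (end₂ e))
    flips e with subst (Walk CubeAdj _ _) (d-edge e) (proj₁ (iso (end₁ e) (end₂ e)))
    ... | a ∷ [] = a

    dir : Fin m → Fin k
    dir e = proj₁ (flips e)

    d₁₁ : ∀ e f → dist (end₁ e) (end₁ f) ≡ hamming (ι (end₁ e)) (ι (end₁ f))
    d₁₁ e f = d≡ _ _

    d₁₂ : ∀ e f → dist (end₁ e) (end₂ f) ≡ hamming (ι (end₁ e)) (flipAt (dir f) (ι (end₁ f)))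
    d₁₂ e f = trans (d≡ _ _) (cong (hamming (ι (end₁ e))) (proj₂ (flips f)))

    d₂₁ : ∀ e f → dist (end₂ e) (end₁ f) ≡ hamming (flipAt (dir e) (ι (end₁ e))) (ι (end₁ f))
    d₂₁ e f = trans (d≡ _ _) (cong (flip hamming (ι (end₁ f))) (proj₂ (flips e)))

    d₂₂ : ∀ e f → dist (end₂ e) (end₂ f) ≡
                  hamming (flipAt (dir e) (ι (end₁ e))) (flipAt (dir f) (ι (end₁ f)))
    d₂₂ e f = trans (d≡ _ _) (cong₂ hamming (proj₂ (flips e)) (proj₂ (flips f)))

    dir⇒φ : ∀ {e f} → dir e ≡ dir f → φ G conn e f
    dir⇒φ {e} {f} eq =
        (begin
          dist (end₁ e) (end₁ f)                              ≡⟨ d₁₁ e f ⟩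
          hamming x y                                         ≡⟨ hamming-flip-both (dir e) x y ⟨
          hamming (flipAt (dir e) x) (flipAt (dir e) y)
            ≡⟨ cong (λ i → hamming (flipAt (dir e) x) (flipAt i y)) eq ⟩
          hamming (flipAt (dir e) x) (flipAt (dir f) y)       ≡⟨ d₂₂ e f ⟨
          dist (end₂ e) (end₂ f)                              ∎)
      , (begin
          dist (end₁ e) (end₂ f)                              ≡⟨ d₁₂ e f ⟩
          hamming x (flipAt (dir f) y)                        ≡⟨ hamming-flip-swap (dir f) x y ⟩
          hamming (flipAt (dir f) x) y
            ≡⟨ cong (λ i → hamming (flipAt i x) y) eq ⟨
          hamming (flipAt (dir e) x) y                        ≡⟨ d₂₁ e f ⟨
          dist (end₂ e) (end₁ f)                              ∎)
      where
      open ≡-Reasoning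
      x = ι (end₁ e)
      y = ι (end₁ f)

    φ⇒θ : ∀ {e f} → φ G conn e f → θ G conn e f
    φ⇒θ {e} {f} (p , q) eq =
      -- If θ failed, all four distances would be equal, yet flipping one end of `f` must change the
      -- distance to `end₁ e`.
      hamming-flip-≢ (dir f) (ι (end₁ e)) (ι (end₁ f))
        (trans (sym (d₁₂ e f)) (trans (sym (equal-summands p q eq)) (d₁₁ e f)))

    θ⇒dir : ∀ {e f} → θ G conn e f → dir e ≡ dir f
    -- By contraposition: distinct coordinates balance the sums and so refute θ.
    θ⇒dir {e} {f} θef = decidable-stable (dir e ≟ dir f) λ dir≢ → θef
      (+-≡-resp (d₁₁ e f) (d₂₂ e f) (d₁₂ e f) (d₂₁ e f)
        (hamming-flip-distinct dir≢ (ι (end₁ e)) (ι (end₁ f))))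

  -- Runs of the procedure

  -- The common shape of both kinds of step. Termination and the general invariant use steps only
  -- through it.
  step-removes : ∀ {S 𝒫 S′ 𝒫′} → Step G conn (S , 𝒫) (S′ , 𝒫′) →
    ∃[ K ] (S′ ≡ S ─ K × 𝒫′ ≡ K ∷ 𝒫 × K ⊆ S × Nonempty K × IsClique _~_ K)
  step-removes (whole (comp , _) clique) =
    _ , refl , refl , component-⊆ comp , component-nonempty comp , clique
  step-removes (extract (comp , _) _ K⊆C ne clique) =
    _ , refl , refl , component-⊆ comp ∘ K⊆C , ne , clique

  step-accessible : ∀ S 𝒫 → Acc _⊂_ S → Acc (flip (Step G conn)) (S , 𝒫)
  step-accessible S 𝒫 (acc rs) = acc λ {s} → next s
    where
    next : ∀ s → Step G conn (S , 𝒫) s → Acc (flip (Step G conn)) s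
    next (S′ , 𝒫′) st with step-removes st
    ... | K , refl , refl , K⊆S , ne , _ = step-accessible _ _ (rs (q⊆p⇒p─q⊂p K⊆S ne))

  progress : ∀ {S 𝒫} → Nonempty S → ∃ (Step G conn (S , 𝒫))
  progress {S} {𝒫} ne = choose (largestComponent φAdj? S ne) (isClique? φAdj? _)
    where
    singleton-clique : ∀ x → IsClique _~_ ⁅ x ⁆
    singleton-clique x a∈ b∈ a≢b =
      contradiction (trans (x∈⁅y⁆⇒x≡y x a∈) (sym (x∈⁅y⁆⇒x≡y x b∈))) a≢b
    choose : (L : ∃ (IsLargestComponent _~_ S)) → Dec (IsClique _~_ (proj₁ L)) →
             ∃ (Step G conn (S , 𝒫))
    choose (C , largest) (yes clique) = _ , whole largest clique
    choose (C , largest) (no ¬clique) with component-nonempty (proj₁ largest)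
    -- A singleton is always a legal extraction, so the loop cannot get stuck here.
    ... | x , x∈C = _ , extract largest ¬clique
      (λ y∈ → subst (_∈ C) (sym (x∈⁅y⁆⇒x≡y x y∈)) x∈C) (x , x∈⁅x⁆ x) (singleton-clique x)

  preserved : (I : State m → Set) → (∀ {s t} → Step G conn s t → I s → I t) →
              ∀ {s t} → Star (Step G conn) s t → I s → I t
  preserved I pres = Star.fold (λ s t → I s → I t) (λ st k → k ∘ pres st) id

  -- `apart` is what makes a class newly cut out of `S` disjoint from the earlier ones. `count`
  -- holds because each new class uses up at least one edge of `S`.
  record Invariant (s : State m) : Set where
    private
      S = proj₁ s
      𝒫 = proj₂ s
    field
      nonempty : All Nonempty 𝒫
      disjoint : AllPairs (λ A B → Empty (A ∩ B)) 𝒫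
      apart    : All (λ A → Empty (A ∩ S)) 𝒫
      covering : ∀ e → e ∈ S ⊎ Any (e ∈_) 𝒫
      cliques  : All (IsClique _~_) 𝒫
      count    : ∣ S ∣ + length 𝒫 ≤ m

  invariant-start : Invariant (start G conn)
  invariant-start = record
    { nonempty = [] ; disjoint = [] ; apart = [] ; covering = λ _ → inj₁ ∈⊤ ; cliques = []
    ; count = ≤-reflexive (trans (+-identityʳ _) (∣⊤∣≡n m)) }

  invariant-step : ∀ {s t} → Step G conn s t → Invariant s → Invariant t
  invariant-step {S , 𝒫} {S′ , 𝒫′} st inv with step-removes st
  ... | K , refl , refl , K⊆S , ne , clique = record
    { nonempty = ne ∷ I.nonempty
    ; disjoint = All.map (∩-empty-sym ∘ ∩-empty-monoʳ K⊆S) I.apart ∷ I.disjoint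
    ; apart    = ∩-empty (λ x∈K x∈S─K → x∈p─q⇒x∉q S K x∈S─K x∈K)
               ∷ All.map (∩-empty-monoʳ (p─q⊆p S K)) I.apart
    ; covering = covering′
    ; cliques  = clique ∷ I.cliques
    -- The successor from the longer list is paid for by the strict drop in the size of `S`.
    ; count    = ≤-trans (≤-reflexive (+-suc _ _))
                   (≤-trans (+-monoˡ-≤ (length 𝒫) (p⊂q⇒∣p∣<∣q∣ (q⊆p⇒p─q⊂p K⊆S ne))) I.count)
    }
    where
    module I = Invariant inv
    covering′ : ∀ e → e ∈ S ─ K ⊎ Any (e ∈_) (K ∷ 𝒫)
    covering′ e with I.covering e
    ... | inj₂ e∈𝒫 = inj₂ (there e∈𝒫)
    ... | inj₁ e∈S with x∈p⇒x∈p─q⊎x∈q K e∈S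
    ...   | inj₁ e∈S─K = inj₁ e∈S─K
    ...   | inj₂ e∈K   = inj₂ (here e∈K)

  invariant⇒partition : ∀ {S 𝒫} → Empty S → Invariant (S , 𝒫) → IsPartition 𝒫
  invariant⇒partition empty inv = nonempty , disjoint , covers
    where
    open Invariant inv
    covers : ∀ e → Any (e ∈_) _
    covers e with covering e
    ... | inj₁ e∈S = ⊥-elim (empty (e , e∈S))
    ... | inj₂ e∈𝒫 = e∈𝒫

  -- Runs on a partial cube

  module _ (D : Direction) where
    open Direction D

    -- `saturated` says that `S` is a union of whole direction classes, so that no component of the
    -- remaining graph is a truncated class.
    record CubeInvariant (s : State m) : Set where
      field
        saturated : ∀ {x y} → x ∈ proj₁ s → dir x ≡ dir y → y ∈ proj₁ s
        classes   : All (IsθClass G conn) (proj₂ s)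

    -- Each φ-step preserves the direction, and two distinct edges of equal direction are joined by
    -- a single φ-step, which saturation keeps inside `S`.
    component⇔dir : ∀ {S C} → (∀ {x y} → x ∈ S → dir x ≡ dir y → y ∈ S) →
      IsComponent _~_ S C → ∃[ x ] (∀ y → y ∈ C ⇔ dir x ≡ dir y)
    component⇔dir {S} {C} sat (x , x∈S , C⇔) =
      x , λ y → mk⇔ (constant ∘ to (C⇔ y)) (from (C⇔ y) ∘ joined)
      where
      constant : ∀ {a b} → Star (Induced _~_ S) a b → dir a ≡ dir b
      constant ε = refl
      constant ((_ , _ , _ , r) ◅ p) = trans (θ⇒dir (φ⇒θ r)) (constant p)
      joined : ∀ {y} → dir x ≡ dir y → Star (Induced _~_ S) x y
      joined {y} eq with x ≟ y
      ... | yes refl = ε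
      ... | no x≢y   = (x∈S , sat x∈S eq , x≢y , dir⇒φ eq) ◅ ε

    cubeInvariant-step : ∀ {s t} → Step G conn s t → CubeInvariant s → CubeInvariant t
    cubeInvariant-step (whole {S} {C = C} (comp , _) _) inv
      with component⇔dir (CubeInvariant.saturated inv) comp
    ... | x , C⇔ = record
      { saturated = λ {a} {b} a∈ eq →
          x∈p∧x∉q⇒x∈p─q (saturated (p─q⊆p S C a∈) eq)
            -- If `b` were deleted with `C`, then `a`, having the same direction, would have been
            -- deleted too.
            λ b∈C → x∈p─q⇒x∉q S C a∈ (from (C⇔ a) (trans (to (C⇔ b) b∈C) (sym eq)))
      ; classes = (x , λ y → mk⇔ (dir⇒θ ∘ to (C⇔ y)) (from (C⇔ y) ∘ θ⇒dir)) ∷ classes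
      }
      where open CubeInvariant inv
    -- This case is impossible: all edges of a component share one direction, so the component is a
    -- clique.
    cubeInvariant-step (extract (comp , _) ¬clique _ _ _) inv
      with component⇔dir (CubeInvariant.saturated inv) comp
    ... | x , C⇔ = contradiction
      (λ {a} {b} a∈ b∈ a≢b → a≢b , dir⇒φ (trans (sym (to (C⇔ a) a∈)) (to (C⇔ b) b∈))) ¬clique

    -- The common edge `e` links the two representatives through `dir`, where equality is symmetric
    -- and transitive.
    θClass-unique : ∀ {A B e} → IsθClass G conn A → IsθClass G conn B → e ∈ A → e ∈ B → A ≡ B
    θClass-unique a b e∈A e∈B = ⊆-antisym (includes a b e∈A e∈B) (includes b a e∈B e∈A)
      where
      includes : ∀ {A B e} → IsθClass G conn A → IsθClass G conn B → e ∈ A → e ∈ B → A ⊆ B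
      includes {e = e} (a , A⇔) (b , B⇔) e∈A e∈B {f} f∈A = from (B⇔ f) (dir⇒θ
        (trans (θ⇒dir (to (B⇔ e) e∈B)) (trans (sym (θ⇒dir (to (A⇔ e) e∈A))) (θ⇒dir (to (A⇔ f) f∈A)))))

    output-θClasses : ∀ {𝒫} → All (IsθClass G conn) 𝒫 → IsPartition 𝒫 → EqualsθClasses G conn 𝒫
    output-θClasses {𝒫} classes (_ , _ , covers) A = mk⇔ (All.lookup classes) listed
      where
      listed : IsθClass G conn A → A ∈ˡ 𝒫
      listed (e , A⇔) with find (covers e)
      -- The representative `e` lies in `A` because θ is reflexive (`dir⇒θ refl`) and in the listed
      -- class `B` by covering, so `A` and `B` coincide.
      ... | B , B∈𝒫 , e∈B = subst (_∈ˡ 𝒫)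
        (θClass-unique (All.lookup classes B∈𝒫) (e , A⇔) e∈B (from (A⇔ e) (dir⇒θ refl))) B∈𝒫

-- Termination and properties of the output

theorem2p17 : ∀ {n m : ℕ} (G : Graph n m) (conn : Connected G) →
    Terminates G conn ×
    (∀ 𝒫 → Outputs G conn 𝒫 →
    IsPartition 𝒫
    × All (IsClique (φAdj G conn)) 𝒫
    × All (IsMatching G) 𝒫
    × (PartialCube G conn → EqualsθClasses G conn 𝒫)
    × length 𝒫 ≤ m)
theorem2p17 G conn =
    (step-accessible G conn _ _ (⊂-wellFounded _) , λ _ → progress G conn)
  , λ { 𝒫 (S , run , empty) →
      let inv  = preserved G conn (Invariant G conn) (invariant-step G conn) run (invariant-start G conn)
          part = invariant⇒partition G conn empty inv
          open Invariant inv
      in part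
       , cliques
       , All.map (clique⇒matching G conn) cliques
       , (λ pc → let D = direction G conn pc in
           output-θClasses G conn D
             (CubeInvariant.classes
               (preserved G conn (CubeInvariant G conn D) (cubeInvariant-step G conn D) run
                 -- Initially `S` is the full edge set, so saturation is immediate.
                 (record { saturated = λ _ _ → ∈⊤ ; classes = [] })))
             part)
       , ≤-trans (m≤n+m _ ∣ S ∣) count }
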